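{- For every $n\ge 0$, one has $|FP_n|=C_n=\frac{1}{n+1}\binom{2n}{n}$.
   Context: $I_n$ is the set of inversion sequences of length $n$, i.e. integer sequences $\sigma=(\sigma_1,\ldots,\sigma_n)$ with $0\le\sigma_i<i$ for every $1\le i\le n$ (the empty sequence is allowed, with $n=0$). For a finite integer sequence $\sigma$ of length $n$, $\Theta(\sigma)$ is the sequence of length $n$ defined by $\Theta(\sigma)_i=\#\{j<i:\sigma_j<\sigma_i\}$. $FP_n=\{\sigma\in I_n:\Theta(\sigma)=\sigma\}$. -}

module Defs where

open import Data.Fin.Base using (Fin; toℕ)
import Data.Fin.Properties as Fin
open import Data.Nat.Base using (ℕ; zero; suc; _+_; _*_; _<_; z<s; s<s)
open import Data.Nat.Combinatorics
  using (_C_; nCn≡1; nC1≡n; nCk≡nC[n∸k]; k>n⇒nCk≡0; nCk+nC[k+1]≡[n+1]C[k+1])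
import Data.Nat.Coprimality as Coprime
open import Data.Nat.Divisibility using (_∣_; divides)
open import Data.Nat.DivMod using (_/_; m*[n/m]≡n)
open import Data.Nat.Properties
open import Data.Refinement using (Refinement; Refinement-syntax; value)
open import Data.Vec.Base using (Vec; allFin; count; lookup; tabulate)
open import Relation.Binary.PropositionalEquality
open import Relation.Nullary.Decidable using (_×-dec_)

-- Entries are indexed from 0, so the bound 0 ≤ σᵢ < i for 1 ≤ i ≤ n becomes
-- lookup σ i < suc (toℕ i).  The membership proofs in I and FP are irrelevant,
-- so two elements are propositionally equal as soon as their sequences are.
I : ℕ → Set
I n = [ σ ∈ Vec ℕ n ∣ (∀ (i : Fin n) → lookup σ i < suc (toℕ i)) ]

Θ : ∀ {n} → Vec ℕ n → Vec ℕ n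
Θ {n} σ = tabulate λ i →
  count (λ j → (j Fin.<? i) ×-dec (lookup σ j <? lookup σ i)) (allFin n)

FP : ℕ → Set
FP n = [ σ ∈ I n ∣ Θ (value σ) ≡ value σ ]

-- The floor in _/_ has no effect: see suc-n*catalan below.
catalan : ℕ → ℕ
catalan n = ((2 * n) C n) / suc n

private
  absorption : ∀ n k → suc k * (suc n C suc k) ≡ suc n * (n C k)
  absorption zero zero = refl
  absorption zero (suc k) = begin
    suc (suc k) * (1 C suc (suc k)) ≡⟨ cong (suc (suc k) *_) (k>n⇒nCk≡0 (s<s (z<s {k}))) ⟩
    suc (suc k) * 0                 ≡⟨ *-zeroʳ (suc (suc k)) ⟩
    0                               ≡⟨ cong (1 *_) (k>n⇒nCk≡0 (z<s {k})) ⟨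
    1 * (0 C suc k)                 ∎
    where open ≡-Reasoning
  absorption (suc n) zero = begin
    1 * (suc (suc n) C 1)       ≡⟨ *-identityˡ _ ⟩
    suc (suc n) C 1             ≡⟨ nC1≡n (suc (suc n)) ⟩
    suc (suc n)                 ≡⟨ *-identityʳ _ ⟨
    suc (suc n) * 1             ≡⟨ cong (suc (suc n) *_) (nCn≡1 (suc n)) ⟨
    suc (suc n) * (suc n C suc n)
      ≡⟨ cong (suc (suc n) *_) (nCk≡nC[n∸k] {0} {suc n} 0≤n) ⟨
    suc (suc n) * (suc n C 0)   ∎
    where
    open ≡-Reasoning
    0≤n = <⇒≤ (z<s {n})
  absorption (suc n) (suc k) = begin
    suc (suc k) * (suc (suc n) C suc (suc k))
      ≡⟨ cong (suc (suc k) *_) (nCk+nC[k+1]≡[n+1]C[k+1] (suc n) (suc k)) ⟨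
    suc (suc k) * (c + (suc n C suc (suc k)))
      ≡⟨ *-distribˡ-+ (suc (suc k)) c _ ⟩
    (c + suc k * c) + suc (suc k) * (suc n C suc (suc k))
      ≡⟨ cong₂ (λ x y → (c + x) + y) (absorption n k) (absorption n (suc k)) ⟩
    (c + suc n * (n C k)) + suc n * (n C suc k)
      ≡⟨ +-assoc c _ _ ⟩
    c + (suc n * (n C k) + suc n * (n C suc k))
      ≡⟨ cong (c +_) (*-distribˡ-+ (suc n) (n C k) (n C suc k)) ⟨
    c + suc n * ((n C k) + (n C suc k))
      ≡⟨ cong (λ x → c + suc n * x) (nCk+nC[k+1]≡[n+1]C[k+1] n k) ⟩
    c + suc n * c ∎
    where
    open ≡-Reasoning
    c = suc n C suc k

  suc-n∣2nCn : ∀ n → suc n ∣ (2 * n) C n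
  suc-n∣2nCn n = Coprime.coprime-divisor {suc n} {suc (2 * n)} coprime
    (divides (suc (2 * n) C suc n)
      (trans (sym (absorption (2 * n) n)) (*-comm (suc n) (suc (2 * n) C suc n))))
    where
    n-coprime : Coprime.Coprime n (suc n)
    n-coprime = Coprime.sym (subst (λ m → Coprime.Coprime m n) (+-comm n 1)
      (Coprime.coprime-+ {1} {n} (Coprime.1-coprimeTo n)))

    coprime : Coprime.Coprime (suc n) (suc (2 * n))
    coprime = Coprime.sym (subst (λ m → Coprime.Coprime (suc (n + m)) (suc n))
      (sym (+-identityʳ n)) (Coprime.coprime-+ {n} {suc n} n-coprime))

suc-n*catalan : ∀ n → suc n * catalan n ≡ (2 * n) C n
suc-n*catalan n = m*[n/m]≡n (suc-n∣2nCn n)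

{-# OPTIONS --safe #-}
-- Build a fixed point of Θ from left to right.  After a prefix of length m, put
-- c y = #{entries of the prefix below y}; a value x may be appended iff c x = x.
-- By induction y ≤ c y for all y ≤ m, so appending x destroys every admissible value
-- above x, keeps the others, and makes m + 1 admissible.  Hence a prefix with k
-- admissible values has one child with j + 1 admissible values for each 1 ≤ j ≤ k:
-- this is the Catalan generating tree, whose levels are counted by ballot numbers.
module Submission where

open import Defs using (FP; Θ; catalan; suc-n*catalan)
open import Data.Bool.Base using (Bool; true; false; if_then_else_)
open import Data.Nat.Base
open import Data.Nat.Combinatorics using (_C_; nCn≡1; nC1≡n; nCk≡nC[n∸k];
  k>n⇒nCk≡0; nCk+nC[k+1]≡[n+1]C[k+1])
open import Data.Nat.Properties
open import Data.Nat.Tactic.RingSolver using (solve-∀)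
open import Data.Fin.Base using (Fin; zero; suc; toℕ)
import Data.Fin.Properties as Fin
open import Data.Irrelevant using ([_])
open import Data.Product.Base using (Σ; ∃; _×_; _,_; proj₂)
open import Data.Refinement using (_,_)
open import Data.Sum.Base using (_⊎_; inj₁; inj₂; [_,_]′)
open import Data.Sum.Function.Propositional using (_⊎-cong_)
open import Data.Unit.Base using (⊤; tt)
open import Data.Vec.Base using (Vec; []; _∷_; allFin; count; lookup; tabulate)
open import Data.Vec.Properties using (lookup∘tabulate; tabulate∘lookup; tabulate-cong; ≡-dec)
open import Function.Base using (id; _∘_)
open import Function.Bundles using (_↔_; mk↔ₛ′)
open import Function.Construct.Composition using (_↔-∘_)
open import Function.Related.Propositional using (bijection; module EquationalReasoning)
open import Function.Construct.Symmetry using (↔-sym)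
open import Level using (0ℓ)
open import Relation.Binary.PropositionalEquality
open import Relation.Nullary.Decidable using (does; yes; no; _×-dec_; dec-true; dec-false; recompute)
open import Relation.Nullary.Negation using (contradiction)
open import Relation.Unary using (Pred; Decidable)

-- Ballot numbers

-- The number of descendants, n levels below, of a node with k children in the
-- generating tree.
ballot : ℕ → ℕ → ℕ
ballot zero    k       = 1
ballot (suc n) zero    = 0
ballot (suc n) (suc k) = ballot (suc n) k + ballot n (2 + k)

nC0≡1 : ∀ n → n C 0 ≡ 1
nC0≡1 n = trans (nCk≡nC[n∸k] {0} {n} z≤n) (nCn≡1 n)

private
  base-rearrange : ∀ s x → s + 1 + x ≡ 1 + (s + x)
  base-rearrange = solve-∀

  step-rearrange : ∀ s t x y → s + t + (x + y) ≡ (s + y) + (t + x)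
  step-rearrange = solve-∀

  regroup : ∀ k a b d → (2 + k) * (b + d) + (1 + k) * (a + b) ≡
    ((2 + k) * d + (1 + k) * b) + ((1 + k) * b + k * a) + (a + b)
  regroup = solve-∀

  collect : ∀ n a b → n * b + n * a + (a + b) ≡ (1 + n) * (a + b)
  collect = solve-∀

  shift-index : ∀ n k → n + n + (2 + k) ≡ (1 + n) + (1 + n) + k
  shift-index = solve-∀

  central-index : ∀ p → 1 + (p + p + 1) ≡ 2 * (1 + p)
  central-index = solve-∀

  split : ∀ p z → 2 * (1 + p) * z ≡ (2 + p) * z + p * z
  split = solve-∀

-- The reflection formula: a ballot number is a difference of two neighbouring binomials in row
-- `2n + k + 1`, written additively to avoid truncated subtraction. By Pascal's rule this difference
-- obeys the recurrence of `ballot`.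
ballot-C : ∀ n k →
  ballot (suc n) k + (suc (n + n + k) C n) ≡ suc (n + n + k) C suc n
-- Here the ballot number is `0`, and the two middle binomials of the odd row `2n + 1` agree by
-- symmetry.
ballot-C n zero = begin
  suc (n + n + 0) C n                       ≡⟨ nCk≡nC[n∸k] {n} {suc (n + n + 0)} n≤ ⟩
  suc (n + n + 0) C (suc (n + n + 0) ∸ n)   ≡⟨ cong (suc (n + n + 0) C_) gap ⟩
  suc (n + n + 0) C suc n                   ∎
  where
  open ≡-Reasoning
  n≤ : n ≤ suc (n + n + 0)
  n≤ = ≤-trans (m≤m+n n n) (≤-trans (m≤m+n (n + n) 0) (n≤1+n _))
  gap : suc (n + n + 0) ∸ n ≡ suc n
  gap = trans (cong (_∸ n) (trans (cong suc (+-identityʳ (n + n))) (sym (+-suc n n)))) (m+n∸m≡n n (suc n))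
ballot-C zero (suc k) = begin
  ballot 1 k + 1 + (suc (suc k) C 0)   ≡⟨ cong (λ x → ballot 1 k + 1 + x) (trans (nC0≡1 (2 + k)) (sym (nC0≡1 (1 + k)))) ⟩
  ballot 1 k + 1 + (suc k C 0)         ≡⟨ base-rearrange (ballot 1 k) (suc k C 0) ⟩
  suc (ballot 1 k + (suc k C 0))       ≡⟨ cong suc (ballot-C zero k) ⟩
  suc (suc k C 1)                      ≡⟨ cong suc (nC1≡n (suc k)) ⟩
  suc (suc k)                          ≡⟨ nC1≡n (suc (suc k)) ⟨
  suc (suc k) C 1                      ∎
  where open ≡-Reasoning
-- Both induction hypotheses live in row `N`, the goal in row `suc N` up to the rewriting of its
-- index done by this transport.
ballot-C (suc n) (suc k) = subst
  (λ N → ballot (2 + n) k + ballot (1 + n) (2 + k) + (suc N C suc n) ≡ suc N C (2 + n))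
  (sym (+-suc (suc n + suc n) k)) (begin
    s + t + (suc N C suc n)                 ≡⟨ cong (s + t +_) (nCk+nC[k+1]≡[n+1]C[k+1] N n) ⟨
    s + t + ((N C n) + (N C suc n))         ≡⟨ step-rearrange s t (N C n) (N C suc n) ⟩
    (s + (N C suc n)) + (t + (N C n))       ≡⟨ cong₂ _+_ (ballot-C (suc n) k) ih ⟩
    (N C (2 + n)) + (N C suc n)             ≡⟨ +-comm (N C (2 + n)) _ ⟩
    (N C suc n) + (N C (2 + n))             ≡⟨ nCk+nC[k+1]≡[n+1]C[k+1] N (suc n) ⟩
    suc N C (2 + n)                         ∎)
  where
  open ≡-Reasoning
  N = suc (suc n + suc n + k)
  s = ballot (2 + n) k
  t = ballot (1 + n) (2 + k)
  ih : t + (N C n) ≡ N C suc n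
  ih = subst (λ M → t + (M C n) ≡ M C suc n) (cong suc (shift-index n k)) (ballot-C n (2 + k))

-- (k + 1) C(n, k + 1) = (n − k) C(n, k), without the subtraction.
[k+1]*nC[k+1]+k*nCk≡n*nCk : ∀ n k → suc k * (n C suc k) + k * (n C k) ≡ n * (n C k)
[k+1]*nC[k+1]+k*nCk≡n*nCk zero zero = cong₂ _+_ (cong (1 *_) (k>n⇒nCk≡0 {0} {1} z<s)) refl
[k+1]*nC[k+1]+k*nCk≡n*nCk zero (suc k)
  rewrite k>n⇒nCk≡0 {0} {2 + k} z<s | k>n⇒nCk≡0 {0} {1 + k} z<s
  = cong₂ _+_ (*-zeroʳ (2 + k)) (*-zeroʳ (1 + k))
[k+1]*nC[k+1]+k*nCk≡n*nCk (suc n) zero = begin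
  1 * (suc n C 1) + 0    ≡⟨ trans (+-identityʳ _) (*-identityˡ _) ⟩
  suc n C 1              ≡⟨ nC1≡n (suc n) ⟩
  suc n                  ≡⟨ *-identityʳ (suc n) ⟨
  suc n * 1              ≡⟨ cong (suc n *_) (nC0≡1 (suc n)) ⟨
  suc n * (suc n C 0)    ∎
  where open ≡-Reasoning
[k+1]*nC[k+1]+k*nCk≡n*nCk (suc n) (suc k) = begin
  (2 + k) * (suc n C (2 + k)) + (1 + k) * (suc n C suc k)
    ≡⟨ cong₂ (λ x y → (2 + k) * x + (1 + k) * y) (nCk+nC[k+1]≡[n+1]C[k+1] n (suc k)) (nCk+nC[k+1]≡[n+1]C[k+1] n k) ⟨
  (2 + k) * (b + d) + (1 + k) * (a + b)
    ≡⟨ regroup k a b d ⟩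
  ((2 + k) * d + (1 + k) * b) + ((1 + k) * b + k * a) + (a + b)
    ≡⟨ cong₂ (λ x y → x + y + (a + b)) ([k+1]*nC[k+1]+k*nCk≡n*nCk n (suc k)) ([k+1]*nC[k+1]+k*nCk≡n*nCk n k) ⟩
  n * b + n * a + (a + b)
    ≡⟨ collect n a b ⟩
  suc n * (a + b)
    ≡⟨ cong (suc n *_) (nCk+nC[k+1]≡[n+1]C[k+1] n k) ⟩
  suc n * (suc n C suc k) ∎
  where
  open ≡-Reasoning
  a = n C k
  b = n C suc k
  d = n C (2 + k)

-- For `n = p + 1`, `ballot-C` gives `t = y - x`, and neighbouring binomials in row `2n` satisfy
-- `(p + 1) y = (p + 2) x`. Hence `(p + 2) t = (p + 2) y - (p + 1) y = y`.
suc-n*ballot : ∀ n → suc n * ballot n 1 ≡ (2 * n) C n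
suc-n*ballot zero    = refl
suc-n*ballot (suc p) = +-cancelʳ-≡ ((2 + p) * x) _ _ (begin
  (2 + p) * t + (2 + p) * x   ≡⟨ *-distribˡ-+ (2 + p) t x ⟨
  (2 + p) * (t + x)           ≡⟨ cong ((2 + p) *_) t+x≡y ⟩
  y + (1 + p) * y             ≡⟨ cong (y +_) shift ⟩
  y + (2 + p) * x             ∎)
  where
  open ≡-Reasoning
  N = 2 * suc p
  t = ballot (suc p) 1
  x = N C p
  y = N C suc p

  t+x≡y : t + x ≡ y
  t+x≡y = subst (λ M → t + (M C p) ≡ M C suc p) (central-index p) (ballot-C p 1)

  shift : (1 + p) * y ≡ (2 + p) * x
  shift = +-cancelʳ-≡ (p * x) _ _
    (trans ([k+1]*nC[k+1]+k*nCk≡n*nCk N p) (split p x))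

ballot-n-1≡catalan : ∀ n → ballot n 1 ≡ catalan n
ballot-n-1≡catalan n = *-cancelˡ-≡ (ballot n 1) (catalan n) (suc n)
  (trans (suc-n*ballot n) (sym (suc-n*catalan n)))

-- Fixed points relative to a prefix

-- The shape to which `count` unfolds on a cons, so that counts can be compared entry by entry with
-- `cong₂ sucIf`.
sucIf : Bool → ℕ → ℕ
sucIf b = if b then suc else id

sucIf-+ : ∀ b m n → sucIf b m + n ≡ m + sucIf b n
sucIf-+ true  m n = sym (+-suc m n)
sucIf-+ false m n = refl

infixl 6 _⊕_
-- If `c y` counts the prefix entries below `y`, this is the counting function once `x` has been
-- appended.
_⊕_ : (ℕ → ℕ) → ℕ → ℕ → ℕ
(c ⊕ x) y = sucIf (does (x <? y)) (c y)

⊕-above : ∀ c {x y} → x < y → (c ⊕ x) y ≡ suc (c y)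
⊕-above c {x} {y} x<y = cong (λ b → sucIf b (c y)) (dec-true (x <? y) x<y)

⊕-below : ∀ c {x y} → y ≤ x → (c ⊕ x) y ≡ c y
⊕-below c {x} {y} y≤x = cong (λ b → sucIf b (c y)) (dec-false (x <? y) (≤⇒≯ y≤x))

-- The prefix enters only through its counting function, so the condition can be checked by
-- structural recursion from left to right.
Fixed : (ℕ → ℕ) → ∀ {n} → Vec ℕ n → Set
Fixed c []      = ⊤
Fixed c (x ∷ σ) = c x ≡ x × Fixed (c ⊕ x) σ

Fixed-irrelevant : ∀ c {n} (σ : Vec ℕ n) (p q : Fixed c σ) → p ≡ q
Fixed-irrelevant c []      p        q        = refl
Fixed-irrelevant c (x ∷ σ) (p , ps) (q , qs) =
  cong₂ _,_ (≡-irrelevant p q) (Fixed-irrelevant (c ⊕ x) σ ps qs)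

Extension : (ℕ → ℕ) → ℕ → Set
Extension c n = Σ (Vec ℕ n) (Fixed c)

-- c behaves like the counting function of a fixed prefix of length m.
record Counts (m : ℕ) (c : ℕ → ℕ) : Set where
  field
    dominates : ∀ {y} → y ≤ m → y ≤ c y
    saturates : ∀ {y} → m ≤ y → c y ≡ m

  fixed⇒≤ : ∀ {x} → c x ≡ x → x ≤ m
  fixed⇒≤ {x} cx≡x with ≤-total x m
  ... | inj₁ x≤m = x≤m
  ... | inj₂ m≤x = ≤-reflexive (trans (sym cx≡x) (saturates m≤x))

open Counts

counts-zero : Counts 0 (λ _ → 0)
counts-zero .dominates y≤0 = y≤0
counts-zero .saturates _   = refl

-- Values up to `x` keep their count and those in between gain one; at `suc m` all entries lie
-- below, so domination there follows from saturation.
counts-⊕ : ∀ {m c x} → Counts m c → x ≤ m → Counts (suc m) (c ⊕ x)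
counts-⊕ {m} {c} {x} inv x≤m .saturates {y} m<y =
  trans (⊕-above c (≤-<-trans x≤m m<y)) (cong suc (saturates inv (<⇒≤ m<y)))
counts-⊕ {m} {c} {x} inv x≤m .dominates {y} y≤1+m with y ≤? x
... | yes y≤x = ≤-trans (dominates inv (≤-trans y≤x x≤m)) (≤-reflexive (sym (⊕-below c y≤x)))
... | no  y≰x with m≤n⇒m<n∨m≡n y≤1+m
...   | inj₁ y<1+m = ≤-trans (m≤n⇒m≤1+n (dominates inv (s≤s⁻¹ y<1+m))) (≤-reflexive (sym (⊕-above c (≰⇒> y≰x))))
...   | inj₂ refl  = ≤-reflexive (sym (counts-⊕ inv x≤m .saturates ≤-refl))

-- Counting admissible values

-- At `suc m` this is the number of children of a prefix of length `m`, since `fixed⇒≤` rules out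
-- larger admissible values.
fixes : (ℕ → ℕ) → ℕ → ℕ
fixes c zero    = 0
fixes c (suc b) = sucIf (does (c b ≟ b)) (fixes c b)

fixes-yes : ∀ c {b} → c b ≡ b → fixes c (suc b) ≡ suc (fixes c b)
fixes-yes c {b} p = cong (λ d → sucIf d (fixes c b)) (dec-true (c b ≟ b) p)

fixes-no : ∀ c {b} → c b ≢ b → fixes c (suc b) ≡ fixes c b
fixes-no c {b} ¬p = cong (λ d → sucIf d (fixes c b)) (dec-false (c b ≟ b) ¬p)

fixes-cong : ∀ c d b → (∀ {y} → y < b → c y ≡ d y) → fixes c b ≡ fixes d b
fixes-cong c d zero    eq = refl
fixes-cong c d (suc b) eq = cong₂ (λ v r → sucIf (does (v ≟ b)) r)
  (eq ≤-refl) (fixes-cong c d b (eq ∘ m<n⇒m<1+n))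

fixes-skip : ∀ c {a b} → a ≤ b → (∀ {y} → a ≤ y → y < b → c y ≢ y) →
  fixes c b ≡ fixes c a
fixes-skip c {a} {zero}  z≤n   none = refl
fixes-skip c {a} {suc b} a≤1+b none with m≤n⇒m<n∨m≡n a≤1+b
... | inj₂ refl = refl
... | inj₁ a<1+b = trans (fixes-no c (none a≤b ≤-refl))
  (fixes-skip c a≤b (λ a≤y y<b → none a≤y (m<n⇒m<1+n y<b)))
  where a≤b = s≤s⁻¹ a<1+b

-- If `x` is the `j`-th admissible value, then `fixes c x` is `j - 1` and the child has `j + 1`
-- admissible values: those up to `x`, and the new value `suc m`. Strictly between, the raised count
-- exceeds the value.
fixes-⊕ : ∀ {m c x} → Counts m c → c x ≡ x → fixes (c ⊕ x) (2 + m) ≡ 2 + fixes c x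
fixes-⊕ {m} {c} {x} inv cx≡x = begin
  fixes (c ⊕ x) (2 + m)         ≡⟨ fixes-yes (c ⊕ x) (saturates (counts-⊕ inv x≤m) ≤-refl) ⟩
  suc (fixes (c ⊕ x) (suc m))   ≡⟨ cong suc (fixes-skip (c ⊕ x) (s≤s x≤m) exceeds) ⟩
  suc (fixes (c ⊕ x) (suc x))   ≡⟨ cong suc (fixes-cong (c ⊕ x) c (suc x) (⊕-below c ∘ s≤s⁻¹)) ⟩
  suc (fixes c (suc x))         ≡⟨ cong suc (fixes-yes c cx≡x) ⟩
  2 + fixes c x                 ∎
  where
  open ≡-Reasoning
  x≤m = fixed⇒≤ inv cx≡x
  exceeds : ∀ {y} → x < y → y < suc m → (c ⊕ x) y ≢ y
  exceeds x<y y<1+m eq = <-irrefl (sym (trans (sym (⊕-above c x<y)) eq))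
    (s≤s (dominates inv (s≤s⁻¹ y<1+m)))

-- Counting extensions

∃< : (ℕ → Set) → ℕ → Set
∃< A b = ∃ λ x → x < b × A x

∃<-suc : ∀ (A : ℕ → Set) b → ∃< A (suc b) ↔ (∃< A b ⊎ A b)
∃<-suc A b = mk↔ₛ′ to from to∘from from∘to
  where
  place : ∀ {x} → A x → x < b ⊎ x ≡ b → ∃< A b ⊎ A b
  place a (inj₁ x<b)  = inj₁ (_ , x<b , a)
  place a (inj₂ refl) = inj₂ a

  to : ∃< A (suc b) → ∃< A b ⊎ A b
  to (x , x<1+b , a) = place a (m<1+n⇒m<n∨m≡n x<1+b)

  from : ∃< A b ⊎ A b → ∃< A (suc b)
  from (inj₁ (x , x<b , a)) = x , m<n⇒m<1+n x<b , a
  from (inj₂ a)             = b , ≤-refl , a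

  to∘from : ∀ s → to (from s) ≡ s
  to∘from (inj₁ (x , x<b , a)) with m<1+n⇒m<n∨m≡n (m<n⇒m<1+n x<b)
  ... | inj₁ x<b′ = cong (λ p → inj₁ (x , p , a)) (<-irrelevant x<b′ x<b)
  ... | inj₂ x≡b  = contradiction x<b (<-irrefl x≡b)
  to∘from (inj₂ a) with m<1+n⇒m<n∨m≡n (≤-refl {suc b})
  ... | inj₁ b<b  = contradiction b<b (<-irrefl refl)
  ... | inj₂ b≡b  rewrite ≡-irrelevant b≡b refl = refl

  from∘to : ∀ s → from (to s) ≡ s
  from∘to (x , x<1+b , a) with m<1+n⇒m<n∨m≡n x<1+b
  ... | inj₁ x<b  = cong (λ p → x , p , a) (<-irrelevant _ x<1+b)
  ... | inj₂ refl = cong (λ p → x , p , a) (<-irrelevant _ x<1+b)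

FirstStep : (ℕ → ℕ) → ℕ → ℕ → Set
FirstStep c n x = c x ≡ x × Extension (c ⊕ x) n

extension-suc : ∀ {m c} n → Counts m c → Extension c (suc n) ↔ ∃< (FirstStep c n) (suc m)
extension-suc n inv = mk↔ₛ′
  (λ { (x ∷ σ , p , ps) → x , s≤s (fixed⇒≤ inv p) , p , σ , ps })
  (λ { (x , _ , p , σ , ps) → x ∷ σ , p , ps })
  (λ { (x , x<1+m , p , σ , ps) → cong (λ q → x , q , p , σ , ps) (<-irrelevant _ x<1+m) })
  (λ { (x ∷ σ , p , ps) → refl })

Fin-cong : ∀ {m n} → m ≡ n → Fin m ↔ Fin n
Fin-cong refl = mk↔ₛ′ id id (λ _ → refl) (λ _ → refl)

mutual
  extension↔ : ∀ n {m c} → Counts m c → Extension c n ↔ Fin (ballot n (fixes c (suc m)))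
  extension↔ zero inv = mk↔ₛ′ (λ _ → zero) (λ _ → [] , tt)
    (λ { zero → refl }) (λ { ([] , tt) → refl })
  extension↔ (suc n) inv = ∃<FirstStep↔ n inv _ ↔-∘ extension-suc n inv

  -- Lowering the bound `b` follows the recursion of `ballot` in its second argument: an admissible
  -- `b` splits off a child counted by `ballot n (2 + k)`, any other `b` contributes nothing.
  ∃<FirstStep↔ : ∀ n {m c} → Counts m c → ∀ b →
    ∃< (FirstStep c n) b ↔ Fin (ballot (suc n) (fixes c b))
  ∃<FirstStep↔ n inv zero = mk↔ₛ′ (λ ()) (λ ()) (λ ()) (λ ())
  ∃<FirstStep↔ n {m} {c} inv (suc b) with c b ≟ b
  ... | yes cb≡b =
    ∃< (FirstStep c n) (suc b)                              ↔⟨ ∃<-suc (FirstStep c n) b ⟩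
    (∃< (FirstStep c n) b ⊎ FirstStep c n b)                ↔⟨ ∃<FirstStep↔ n inv b ⊎-cong child ⟩
    (Fin (ballot (suc n) k) ⊎ Fin (ballot n (2 + k)))       ↔⟨ ↔-sym Fin.+↔⊎ ⟩
    Fin (ballot (suc n) (suc k))                            ↔⟨ Fin-cong (cong (ballot (suc n)) (sym (fixes-yes c cb≡b))) ⟩
    Fin (ballot (suc n) (fixes c (suc b)))                  ∎
    where
    open EquationalReasoning {k = bijection}
    k = fixes c b

    known : FirstStep c n b ↔ Extension (c ⊕ b) n
    known = mk↔ₛ′ proj₂ (cb≡b ,_) (λ _ → refl)
      (λ { (p , e) → cong (_, e) (≡-irrelevant cb≡b p) })

    child : FirstStep c n b ↔ Fin (ballot n (2 + k))
    child =
      FirstStep c n b                            ↔⟨ known ⟩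
      Extension (c ⊕ b) n                        ↔⟨ extension↔ n (counts-⊕ inv (fixed⇒≤ inv cb≡b)) ⟩
      Fin (ballot n (fixes (c ⊕ b) (2 + m)))     ↔⟨ Fin-cong (cong (ballot n) (fixes-⊕ inv cb≡b)) ⟩
      Fin (ballot n (2 + k))                     ∎
  ... | no cb≢b =
    ∃< (FirstStep c n) (suc b)                  ↔⟨ ∃<-suc (FirstStep c n) b ⟩
    (∃< (FirstStep c n) b ⊎ FirstStep c n b)    ↔⟨ absent ⟩
    ∃< (FirstStep c n) b                        ↔⟨ ∃<FirstStep↔ n inv b ⟩
    Fin (ballot (suc n) (fixes c b))            ↔⟨ Fin-cong (cong (ballot (suc n)) (sym (fixes-no c cb≢b))) ⟩
    Fin (ballot (suc n) (fixes c (suc b)))      ∎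
    where
    open EquationalReasoning {k = bijection}

    absent : (∃< (FirstStep c n) b ⊎ FirstStep c n b) ↔ ∃< (FirstStep c n) b
    absent = mk↔ₛ′ [ id , (λ { (p , _) → contradiction p cb≢b }) ]′ inj₁ (λ _ → refl)
      (λ { (inj₁ _) → refl ; (inj₂ (p , _)) → contradiction p cb≢b })

-- Fixed points of Θ

smallerBefore : ∀ {n} → Vec ℕ n → Fin n → ℕ
smallerBefore {n} σ i =
  count (λ j → (j Fin.<? i) ×-dec (lookup σ j <? lookup σ i)) (allFin n)

count-tabulate-cong : ∀ {A B : Set} {P : Pred A 0ℓ} {Q : Pred B 0ℓ}
  (P? : Decidable P) (Q? : Decidable Q) {n} (f : Fin n → A) (g : Fin n → B) →
  (∀ j → does (P? (f j)) ≡ does (Q? (g j))) →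
  count P? (tabulate f) ≡ count Q? (tabulate g)
count-tabulate-cong P? Q? {zero}  f g eq = refl
count-tabulate-cong P? Q? {suc n} f g eq =
  cong₂ sucIf (eq zero) (count-tabulate-cong P? Q? (f ∘ suc) (g ∘ suc) (eq ∘ suc))

count-tabulate-none : ∀ {A : Set} {P : Pred A 0ℓ} (P? : Decidable P) {n} (f : Fin n → A) →
  (∀ j → does (P? (f j)) ≡ false) → count P? (tabulate f) ≡ 0
count-tabulate-none P? {zero}  f none = refl
count-tabulate-none P? {suc n} f none =
  cong₂ sucIf (none zero) (count-tabulate-none P? (f ∘ suc) (none ∘ suc))

smallerBefore-zero : ∀ {n} x (σ : Vec ℕ n) → smallerBefore (x ∷ σ) zero ≡ 0
smallerBefore-zero {n} x σ = count-tabulate-none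
  (λ j → (j Fin.<? zero {n}) ×-dec (lookup (x ∷ σ) j <? x)) id (λ _ → refl)

smallerBefore-suc : ∀ {n} x (σ : Vec ℕ n) i →
  smallerBefore (x ∷ σ) (suc i) ≡ sucIf (does (x <? lookup σ i)) (smallerBefore σ i)
smallerBefore-suc x σ i = cong (sucIf (does (x <? lookup σ i)))
  (count-tabulate-cong
    (λ j → (j Fin.<? suc i) ×-dec (lookup (x ∷ σ) j <? lookup σ i))
    (λ j → (j Fin.<? i) ×-dec (lookup σ j <? lookup σ i)) suc id (λ _ → refl))

-- Moving the head `x` from the sequence into the prefix preserves the total number of smaller
-- earlier entries; this carries the inductions relating `Fixed` to the pointwise condition.
smallerBefore-⊕ : ∀ c {n} x (σ : Vec ℕ n) i →
  smallerBefore (x ∷ σ) (suc i) + c (lookup σ i) ≡ smallerBefore σ i + (c ⊕ x) (lookup σ i)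
smallerBefore-⊕ c x σ i = trans
  (cong (_+ c (lookup σ i)) (smallerBefore-suc x σ i))
  (sucIf-+ (does (x <? lookup σ i)) (smallerBefore σ i) (c (lookup σ i)))

pointwise⇒Fixed : ∀ c {n} (σ : Vec ℕ n) →
  (∀ i → smallerBefore σ i + c (lookup σ i) ≡ lookup σ i) → Fixed c σ
pointwise⇒Fixed c []      p = tt
pointwise⇒Fixed c (x ∷ σ) p =
  trans (cong (_+ c x) (sym (smallerBefore-zero x σ))) (p zero) ,
  pointwise⇒Fixed (c ⊕ x) σ (λ i → trans (sym (smallerBefore-⊕ c x σ i)) (p (suc i)))

Fixed⇒pointwise : ∀ c {n} (σ : Vec ℕ n) → Fixed c σ →
  ∀ i → smallerBefore σ i + c (lookup σ i) ≡ lookup σ i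
Fixed⇒pointwise c (x ∷ σ) (p , ps) zero    = trans (cong (_+ c x) (smallerBefore-zero x σ)) p
Fixed⇒pointwise c (x ∷ σ) (p , ps) (suc i) =
  trans (smallerBefore-⊕ c x σ i) (Fixed⇒pointwise (c ⊕ x) σ ps i)

-- When entry `i` is appended, the prefix has length `m + toℕ i`, and `fixed⇒≤` bounds the entry by
-- that length.
Fixed⇒inversion : ∀ {m c n} → Counts m c → (σ : Vec ℕ n) → Fixed c σ →
  ∀ i → lookup σ i < suc (m + toℕ i)
Fixed⇒inversion {m} inv (x ∷ σ) (p , ps) zero    = s≤s (≤-trans (fixed⇒≤ inv p) (m≤m+n m 0))
Fixed⇒inversion {m} inv (x ∷ σ) (p , ps) (suc i) = subst (λ k → lookup σ i < suc k)
  (sym (+-suc m (toℕ i))) (Fixed⇒inversion (counts-⊕ inv (fixed⇒≤ inv p)) σ ps i)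

Θ-fixed⇒Fixed : ∀ {n} (σ : Vec ℕ n) → Θ σ ≡ σ → Fixed (λ _ → 0) σ
Θ-fixed⇒Fixed σ eq = pointwise⇒Fixed (λ _ → 0) σ λ i → begin
  smallerBefore σ i + 0   ≡⟨ +-identityʳ _ ⟩
  smallerBefore σ i       ≡⟨ lookup∘tabulate (smallerBefore σ) i ⟨
  lookup (Θ σ) i          ≡⟨ cong (λ τ → lookup τ i) eq ⟩
  lookup σ i              ∎
  where open ≡-Reasoning

Fixed⇒Θ-fixed : ∀ {n} (σ : Vec ℕ n) → Fixed (λ _ → 0) σ → Θ σ ≡ σ
Fixed⇒Θ-fixed σ ps = trans
  (tabulate-cong (λ i → trans (sym (+-identityʳ _)) (Fixed⇒pointwise (λ _ → 0) σ ps i)))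
  (tabulate∘lookup σ)

FP↔Extension : ∀ n → FP n ↔ Extension (λ _ → 0) n
FP↔Extension n = mk↔ₛ′ to from
  (λ { (σ , ps) → cong (σ ,_) (Fixed-irrelevant (λ _ → 0) σ _ ps) })
  (λ _ → refl)
  where
  to : FP n → Extension (λ _ → 0) n
  -- The proof `eq` is irrelevant; decidable equality of vectors recovers a usable one.
  to ((σ , _) , [ eq ]) = σ , Θ-fixed⇒Fixed σ (recompute (≡-dec _≟_ (Θ σ) σ) eq)

  from : Extension (λ _ → 0) n → FP n
  from (σ , ps) = (σ , [ Fixed⇒inversion counts-zero σ ps ]) , [ Fixed⇒Θ-fixed σ ps ]

theorem4p8 : ∀ (n : ℕ) → FP n ↔ Fin (catalan n)
theorem4p8 n =
  FP n                     ↔⟨ FP↔Extension n ⟩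
  -- For the empty prefix `0` is the only admissible value: `fixes (λ _ → 0) 1` computes to `1`.
  Extension (λ _ → 0) n    ↔⟨ extension↔ n counts-zero ⟩
  Fin (ballot n 1)         ↔⟨ Fin-cong (ballot-n-1≡catalan n) ⟩
  Fin (catalan n)          ∎
  where open EquationalReasoning {k = bijection}
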